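{- Let $\Gamma$ be a connected vertex-transitive digraph that has Property Z, and set $G=\mathrm{Aut}(\Gamma)$. Let $\varphi:\Gamma\to\vec{\mathbb Z}$ be a surjective digraph homomorphism and $\Gamma_0=\varphi^{ -1}(0)$. Assume that $G_v$ acts quasi-primitively on both $\mathrm{in}(v)$ and $\mathrm{out}(v)$ for some vertex $v$ of $\Gamma$. If the pointwise stabilizer $G_{(\Gamma_0)}$ is non-trivial, then $\Gamma$ is highly-arc-transitive.
   Context: A digraph $\Gamma=(V\Gamma,E\Gamma)$ has vertex set $V\Gamma$ and arc set $E\Gamma\subseteq V\Gamma\times V\Gamma$. It is connected if its underlying undirected graph is connected. For a vertex $v$, $\mathrm{in}(v)=\{u:(u,v)\in E\Gamma\}$ and $\mathrm{out}(v)=\{u:(v,u)\in E\Gamma\}$. A digraph homomorphism is a map of vertex sets sending arcs to arcs (preserving direction). $\vec{\mathbb Z}$ is the digraph with vertex set $\mathbb Z$ and arcs $(i,i+1)$, $i\in\mathbb Z$. A connected digraph $\Gamma$ has Property Z if there is a surjective digraph homomorphism $\Gamma\to\vec{\mathbb Z}$ (such a homomorphism is unique up to adding an integer constant). A $k$-arc is a sequence of vertices $v_0,\dots,v_k$ with $(v_i,v_{i+1})\in E\Gamma$ for $0\le i<k$ (a 0-arc is a vertex). $\Gamma$ is vertex-transitive if $\mathrm{Aut}(\Gamma)$ is transitive on vertices, $k$-arc-transitive if $\mathrm{Aut}(\Gamma)$ is transitive on $k$-arcs, and highly-arc-transitive if it is $k$-arc-transitive for all $k$. $G_v$ is the stabilizer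 of $v$, and $G_{(A)}=\{g\in G: a^g=a\text{ for all }a\in A\}$ is the pointwise stabilizer of a set $A$. A transitive group action is quasi-primitive if every normal subgroup of the group acts either trivially or transitively. -}

module Defs where

open import Algebra.Bundles using (Group)
open import Data.Fin.Base using (Fin; inject₁) renaming (suc to fsuc)
open import Data.Integer.Base using (ℤ) renaming (suc to sucℤ)
open import Data.Nat.Base using (ℕ; suc)
open import Data.Product.Base using (∃; ∃-syntax; _×_; _,_; proj₁; proj₂)
open import Data.Sum.Base using (_⊎_)
open import Data.Vec.Functional using (Vector)
open import Function.Bundles using (_↔_; Inverse)
open import Function.Construct.Composition using (_↔-∘_)
open import Function.Construct.Identity using (↔-id)
open import Function.Construct.Symmetry using (↔-sym)
open import Function.Definitions using (Surjective)
open import Level using (Level; _⊔_; 0ℓ) renaming (suc to lsuc)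
open import Relation.Binary.Bundles using (Setoid)
open import Relation.Binary.Core using (Rel; _Preserves_⟶_)
open import Relation.Binary.Construct.Closure.Equivalence using (EqClosure)
import Relation.Binary.Construct.On as On
open import Relation.Binary.PropositionalEquality
  using (_≡_; refl; sym; trans; cong; subst)
import Relation.Binary.PropositionalEquality.Properties as ≡
open import Relation.Nullary.Negation.Core using (¬_)
open import Relation.Unary using (Pred; _∈_)

private
  variable
    a b c ℓ p q : Level

------------------------------------------------------------------------
-- Subgroups

record Subgroup (G : Group c ℓ) (p : Level) : Set (c ⊔ ℓ ⊔ lsuc p) where
  open Group G
  field
    Mem    : Pred Carrier p
    resp   : ∀ {g h} → g ≈ h → g ∈ Mem → h ∈ Mem
    ε-mem  : ε ∈ Mem
    ∙-mem  : ∀ {g h} → g ∈ Mem → h ∈ Mem → g ∙ h ∈ Mem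
    ⁻¹-mem : ∀ {g} → g ∈ Mem → g ⁻¹ ∈ Mem

module _ {G : Group c ℓ} where
  open Group G

  Normal : Subgroup G p → Set (c ⊔ p)
  Normal N = ∀ g {n} → n ∈ Mem → g ⁻¹ ∙ n ∙ g ∈ Mem
    where open Subgroup N

  NonTrivial : Subgroup G p → Set (c ⊔ ℓ ⊔ p)
  NonTrivial H = ∃[ g ] g ∈ Subgroup.Mem H × ¬ (g ≈ ε)

  toGroup : Subgroup G p → Group (c ⊔ p) ℓ
  toGroup H = record
    { Carrier = ∃ Mem
    ; _≈_     = λ g h → proj₁ g ≈ proj₁ h
    ; _∙_     = λ (g , g∈H) (h , h∈H) → g ∙ h , ∙-mem g∈H h∈H
    ; ε       = ε , ε-mem
    ; _⁻¹     = λ (g , g∈H) → g ⁻¹ , ⁻¹-mem g∈H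
    ; isGroup = record
      { isMonoid = record
        { isSemigroup = record
          { isMagma = record
            { isEquivalence = On.isEquivalence proj₁ isEquivalence
            ; ∙-cong        = ∙-cong
            }
          ; assoc = λ g h k → assoc (proj₁ g) (proj₁ h) (proj₁ k)
          }
        ; identity = (λ g → identityˡ (proj₁ g)) , (λ g → identityʳ (proj₁ g))
        }
      ; inverse = (λ g → inverseˡ (proj₁ g)) , (λ g → inverseʳ (proj₁ g))
      ; ⁻¹-cong = ⁻¹-cong
      }
    }
    where open Subgroup H

------------------------------------------------------------------------
-- Right group actions; x ◂ g is the image written xᵍ on paper

record Action (G : Group c ℓ) (S : Setoid a b) : Set (a ⊔ b ⊔ c ⊔ ℓ) where
  open Group G using (ε; _∙_) renaming (Carrier to ∣G∣; _≈_ to _≈ᴳ_)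
  open Setoid S using (_≈_) renaming (Carrier to ∣S∣)
  infixl 6 _◂_
  field
    _◂_    : ∣S∣ → ∣G∣ → ∣S∣
    ◂-cong : ∀ {x y g h} → x ≈ y → g ≈ᴳ h → x ◂ g ≈ y ◂ h
    ◂-ε    : ∀ x → x ◂ ε ≈ x
    ◂-∙    : ∀ x g h → x ◂ (g ∙ h) ≈ x ◂ g ◂ h

module _ {G : Group c ℓ} {S : Setoid a b} (α : Action G S) where
  open Group G using (_⁻¹; inverseʳ)
    renaming (refl to reflᴳ; sym to symᴳ)
  open Setoid S using (_≈_) renaming (Carrier to ∣S∣; refl to reflˢ; sym to symˢ; trans to transˢ)
  open Action α

  Transitive : Set _
  Transitive = ∀ x y → ∃[ g ] x ◂ g ≈ y

  ActsTransitively : Subgroup G p → Set _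
  ActsTransitively H = ∀ x y → ∃[ g ] g ∈ Subgroup.Mem H × x ◂ g ≈ y

  ActsTrivially : Subgroup G p → Set _
  ActsTrivially H = ∀ {g} → g ∈ Subgroup.Mem H → ∀ x → x ◂ g ≈ x

  private
    fix-⁻¹ : ∀ {x g} → x ◂ g ≈ x → x ◂ g ⁻¹ ≈ x
    fix-⁻¹ {x} {g} fix =
      transˢ (◂-cong (symˢ fix) reflᴳ)
      (transˢ (symˢ (◂-∙ x g (g ⁻¹)))
      (transˢ (◂-cong reflˢ (inverseʳ g)) (◂-ε x)))

  PointwiseStabilizer : Pred ∣S∣ p → Subgroup G (a ⊔ b ⊔ p)
  PointwiseStabilizer A = record
    { Mem    = λ g → ∀ x → x ∈ A → x ◂ g ≈ x
    ; resp   = λ g≈h fix x x∈A → transˢ (◂-cong reflˢ (symᴳ g≈h)) (fix x x∈A)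
    ; ε-mem  = λ x _ → ◂-ε x
    ; ∙-mem  = λ {g} {h} fixᵍ fixʰ x x∈A →
        transˢ (◂-∙ x g h) (transˢ (◂-cong (fixᵍ x x∈A) reflᴳ) (fixʰ x x∈A))
    ; ⁻¹-mem = λ fix x x∈A → fix-⁻¹ (fix x x∈A)
    }

  Stabilizer : ∣S∣ → Subgroup G b
  Stabilizer v = record
    { Mem    = λ g → v ◂ g ≈ v
    ; resp   = λ g≈h fix → transˢ (◂-cong reflˢ (symᴳ g≈h)) fix
    ; ε-mem  = ◂-ε v
    ; ∙-mem  = λ {g} {h} fixᵍ fixʰ →
        transˢ (◂-∙ v g h) (transˢ (◂-cong fixᵍ reflᴳ) fixʰ)
    ; ⁻¹-mem = fix-⁻¹
    }

  Subset : Pred ∣S∣ q → Setoid (a ⊔ q) b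
  Subset A = On.setoid {B = ∃ A} S proj₁

  restrict : (H : Subgroup G p) (A : Pred ∣S∣ q) →
             (∀ {g} → g ∈ Subgroup.Mem H → ∀ {x} → x ∈ A → x ◂ g ∈ A) →
             Action (toGroup H) (Subset A)
  restrict H A invariant = record
    { _◂_    = λ (x , x∈A) (g , g∈H) → x ◂ g , invariant g∈H x∈A
    ; ◂-cong = ◂-cong
    ; ◂-ε    = λ x → ◂-ε (proj₁ x)
    ; ◂-∙    = λ x g h → ◂-∙ (proj₁ x) (proj₁ g) (proj₁ h)
    }

-- With the group living in Set ℓ, its subsets are the Set ℓ-valued predicates.
QuasiPrimitive : {G : Group ℓ ℓ} {S : Setoid a b} → Action G S → Set (a ⊔ b ⊔ lsuc ℓ)
QuasiPrimitive {ℓ = ℓ} {G = G} α =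
  Transitive α ×
  (∀ (N : Subgroup G ℓ) → Normal N → ActsTrivially α N ⊎ ActsTransitively α N)

------------------------------------------------------------------------
-- Digraphs

-- (u , v) is an arc when E u v is inhabited.  Nothing below distinguishes
-- different inhabitants of E u v, so E need not be proof-irrelevant.
record Digraph (ℓ : Level) : Set (lsuc ℓ) where
  field
    V : Set ℓ
    E : Rel V ℓ

open Digraph

ℤ⃗ : Digraph 0ℓ
ℤ⃗ = record { V = ℤ ; E = λ i j → j ≡ sucℤ i }

IsHomomorphism : (Γ : Digraph a) (Δ : Digraph b) → (V Γ → V Δ) → Set (a ⊔ b)
IsHomomorphism Γ Δ f = f Preserves E Γ ⟶ E Δ

module _ (Γ : Digraph ℓ) where

  Connected : Set ℓ
  Connected = ∀ u v → EqClosure (E Γ) u v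

  PropertyZ : Set ℓ
  PropertyZ = ∃[ φ ] IsHomomorphism Γ ℤ⃗ φ × Surjective _≡_ _≡_ φ

  In Out : V Γ → Pred (V Γ) ℓ
  In  v u = E Γ u v
  Out v u = E Γ v u

  IsArc : (k : ℕ) → Vector (V Γ) (suc k) → Set ℓ
  IsArc k s = ∀ (i : Fin k) → E Γ (s (inject₁ i)) (s (fsuc i))

  record Automorphism : Set ℓ where
    field
      perm     : V Γ ↔ V Γ
    open Inverse perm public using (to; from; strictlyInverseˡ; strictlyInverseʳ)
    field
      to-hom   : IsHomomorphism Γ Γ to
      from-hom : IsHomomorphism Γ Γ from

  open Automorphism

  private
    from-cong : ∀ g h → (∀ v → to g v ≡ to h v) → ∀ v → from g v ≡ from h v
    from-cong g h g≈h v =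
      trans (cong (from g) (sym (strictlyInverseˡ h v)))
      (trans (cong (from g) (sym (g≈h (from h v))))
             (strictlyInverseʳ g (from h v)))

  -- The product g ∙ h applies g first, matching the right action below.
  Aut : Group ℓ ℓ
  Aut = record
    { Carrier = Automorphism
    ; _≈_     = λ g h → ∀ v → to g v ≡ to h v
    ; _∙_     = λ g h → record
      { perm     = perm h ↔-∘ perm g
      ; to-hom   = λ e → to-hom h (to-hom g e)
      ; from-hom = λ e → from-hom g (from-hom h e)
      }
    ; ε       = record
      { perm     = ↔-id _
      ; to-hom   = λ e → e
      ; from-hom = λ e → e
      }
    ; _⁻¹     = λ g → record
      { perm     = ↔-sym (perm g)
      ; to-hom   = from-hom g
      ; from-hom = to-hom g
      }
    ; isGroup = record
      { isMonoid = record
        { isSemigroup = record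
          { isMagma = record
            { isEquivalence = record
              { refl  = λ _ → refl
              ; sym   = λ g≈h v → sym (g≈h v)
              ; trans = λ g≈h h≈k v → trans (g≈h v) (h≈k v)
              }
            ; ∙-cong = λ {_} {g′} {h} g≈g′ h≈h′ v →
                trans (cong (to h) (g≈g′ v)) (h≈h′ (to g′ v))
            }
          ; assoc = λ _ _ _ _ → refl
          }
        ; identity = (λ _ _ → refl) , (λ _ _ → refl)
        }
      ; inverse = strictlyInverseˡ , strictlyInverseʳ
      ; ⁻¹-cong = λ {g} {h} → from-cong g h
      }
    }

  vertexAction : Action Aut (≡.setoid (V Γ))
  vertexAction = record
    { _◂_    = λ v g → to g v
    ; ◂-cong = λ { {g = g} {h = h} refl g≈h → g≈h _ }
    ; ◂-ε    = λ _ → refl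
    ; ◂-∙    = λ _ _ _ → refl
    }

  VertexTransitive : Set ℓ
  VertexTransitive = Transitive vertexAction

  ArcTransitive : ℕ → Set ℓ
  ArcTransitive k = ∀ s t → IsArc k s → IsArc k t →
                    ∃[ g ] (∀ i → to g (s i) ≡ t i)

  HighlyArcTransitive : Set ℓ
  HighlyArcTransitive = ∀ k → ArcTransitive k

  stabilizerOnIn : ∀ v → Action (toGroup (Stabilizer vertexAction v))
                                (Subset vertexAction (In v))
  stabilizerOnIn v = restrict vertexAction (Stabilizer vertexAction v) (In v)
    λ {g} gv≡v {u} e → subst (E Γ (to g u)) gv≡v (to-hom g e)

  stabilizerOnOut : ∀ v → Action (toGroup (Stabilizer vertexAction v))
                                 (Subset vertexAction (Out v))
  stabilizerOnOut v = restrict vertexAction (Stabilizer vertexAction v) (Out v)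
    λ {g} gv≡v {u} e → subst (λ w → E Γ w (to g u)) gv≡v (to-hom g e)

{-# OPTIONS --safe #-}
-- An automorphism a fixing one level of φ pointwise preserves all levels, so
-- acting as a above that level and as the identity below it is again an
-- automorphism.  Hence if the pointwise stabiliser N of the level of v is
-- transitive on out(v), then already its subgroup fixing everything below is,
-- and arcs can be matched one final vertex at a time; dually for in(v).  As N is
-- normal in G_v, the only other possibility is that N acts trivially on both
-- in(v) and out(v); then its members fix the two adjacent levels, hence, by
-- transitivity and connectedness, every vertex.
module Submission where

open import Defs
open import Algebra.Bundles using (Group)
open import Data.Fin.Base using (fromℕ; inject₁) renaming (zero to fzero; suc to fsuc)
open import Data.Fin.Relation.Unary.Top using (view; ‵fromℕ; ‵inject₁)
open import Data.Integer.Base using (ℤ; 0ℤ; 1ℤ; _+_; _-_; _≤_) renaming (suc to sucℤ)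
open import Data.Integer.Properties
  using (_≤?_; ≤-refl; ≤-trans; ≤-antisym; <⇒≤; ≰⇒>;
         i≤suc[i]; i<j⇒suc[i]≤j; i-j≡0⇒i≡j; i≡j⇒i-j≡0)
open import Data.Integer.Tactic.RingSolver using (solve-∀)
open import Data.Nat.Base using (zero; suc)
open import Data.Product.Base using (∃; ∃₂; ∃-syntax; _×_; _,_; proj₁; proj₂)
open import Data.Sum.Base using (_⊎_; inj₁; inj₂; map)
open import Function.Base using (_∘_; flip; case_of_)
open import Function.Bundles using (_⇔_; mk⇔; mk↔ₛ′; Equivalence)
open import Function.Definitions using (Surjective)
open import Function.Properties.Equivalence using (⇔-isEquivalence)
open import Level using (Level)
open import Relation.Binary.Construct.Closure.Equivalence using (gfold)
open import Relation.Binary.Construct.Closure.ReflexiveTransitive using (ε; _◅_)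
open import Relation.Binary.Construct.Closure.Symmetric using (fwd; bwd)
open import Relation.Binary.Core using (Rel)
open import Relation.Binary.PropositionalEquality
  using (_≡_; refl; sym; trans; cong; cong₂; subst; subst₂; isEquivalence)
open import Relation.Nullary.Decidable.Core using (yes; no)
open import Relation.Nullary.Negation.Core using (contradiction)

private
  variable
    c ℓ p q : Level

sucℤ-minus-sucℤ : ∀ i j → sucℤ i - sucℤ j ≡ i - j
sucℤ-minus-sucℤ = 1+-1+
  where
  -- `sucℤ i` unfolds to `1ℤ + i`, a form the ring solver can read.
  1+-1+ : ∀ i j → (1ℤ + i) - (1ℤ + j) ≡ i - j
  1+-1+ = solve-∀

-- The intersection of `H` and `K`, seen inside `H`.
subgroupOf : {G : Group c ℓ} (H : Subgroup G p) → Subgroup G q → Subgroup (toGroup H) q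
subgroupOf H K = record
  { Mem    = λ h → K.Mem (proj₁ h)
  ; resp   = K.resp
  ; ε-mem  = K.ε-mem
  ; ∙-mem  = K.∙-mem
  ; ⁻¹-mem = K.⁻¹-mem
  }
  where module K = Subgroup K

-- Levels of `φ` and their pointwise stabilisers.

module _ (Γ : Digraph ℓ) (connected : Connected Γ) (φ : Digraph.V Γ → ℤ)
         (φ-hom : IsHomomorphism Γ ℤ⃗ φ) where
  open Digraph Γ
  open Automorphism
  open Group (Aut Γ) using (_∙_; _⁻¹)

  -- Indexed by a vertex of the level rather than by its integer, so that conjugation by `g` simply
  -- trades `x` for `to g x`.
  LevelStabilizer : V → Subgroup (Aut Γ) ℓ
  LevelStabilizer x = PointwiseStabilizer (vertexAction Γ) (λ y → φ y ≡ φ x)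

  FixesLevel : V → Automorphism Γ → Set ℓ
  FixesLevel = Subgroup.Mem ∘ LevelStabilizer

  arc-≤ : ∀ {x y} → E x y → φ x ≤ φ y
  arc-≤ {x} e = subst (φ x ≤_) (sym (φ-hom e)) (i≤suc[i] (φ x))

  -- An arc raises `φ` by one both before and after applying `g`, so the difference is constant
  -- along undirected paths.
  displacement : ∀ (g : Automorphism Γ) x y → φ (to g x) - φ x ≡ φ (to g y) - φ y
  displacement g x y =
    gfold isEquivalence (λ z → φ (to g z) - φ z)
      (λ {u} {v} e → sym (trans (cong₂ _-_ (φ-hom (to-hom g e)) (φ-hom e))
                                (sucℤ-minus-sucℤ (φ (to g u)) (φ u))))
      (connected x y)

  to-level : ∀ g {x y} → φ x ≡ φ y → φ (to g x) ≡ φ (to g y)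
  to-level g {x} {y} eq = cancel (trans (displacement g x y) (cong (φ (to g y) -_) (sym eq)))
    where
    regroup : ∀ i j k → (i - k) - (j - k) ≡ i - j
    regroup = solve-∀
    cancel : ∀ {i j k} → i - k ≡ j - k → i ≡ j
    cancel {i} {j} {k} e = i-j≡0⇒i≡j i j (trans (sym (regroup i j k)) (i≡j⇒i-j≡0 e))

  fixesLevel⇒preserves-φ : ∀ {x} a → FixesLevel x a → ∀ y → φ (to a y) ≡ φ y
  fixesLevel⇒preserves-φ {x} a fix y = i-j≡0⇒i≡j _ _
    (trans (displacement a y x) (i≡j⇒i-j≡0 (cong φ (fix x refl))))

  conjugate : ∀ g {n x} → FixesLevel (to g x) n → FixesLevel x (g ∙ n ∙ g ⁻¹)
  conjugate g fix y eq =
    trans (cong (from g) (fix (to g y) (to-level g eq))) (strictlyInverseʳ g y)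

  conjugate⁻¹ : ∀ g {n x} → FixesLevel x n → FixesLevel (to g x) (g ⁻¹ ∙ n ∙ g)
  conjugate⁻¹ g {n} {x} fix = conjugate (g ⁻¹) {n}
    λ y eq → fix y (trans eq (cong φ (strictlyInverseʳ g x)))

  -- Splicing an automorphism with the identity along a fixed level.

  module Splice (x : V) where

    above : (V → V) → V → V
    above f y with φ y ≤? φ x
    ... | yes _ = y
    ... | no  _ = f y

    above-≤ : ∀ f {y} → φ y ≤ φ x → above f y ≡ y
    above-≤ f {y} y≤x with φ y ≤? φ x
    ... | yes _   = refl
    ... | no  y≰x = contradiction y≤x y≰x

    module _ (f : V → V) (fix : ∀ y → φ y ≡ φ x → f y ≡ y) where

      -- Exactly on the level of `x` the identity branch is taken, and `f` agrees with it there.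
      above-≥ : ∀ {y} → φ x ≤ φ y → above f y ≡ f y
      above-≥ {y} x≤y with φ y ≤? φ x
      ... | yes y≤x = sym (fix y (≤-antisym y≤x x≤y))
      ... | no  _   = refl

      -- No arc crosses the level of `x`: `φ` grows by exactly one along it, so both ends lie on or
      -- above the level, or both on or below it.
      above-hom : IsHomomorphism Γ Γ f → IsHomomorphism Γ Γ (above f)
      above-hom f-hom {y} {z} e with φ x ≤? φ y
      ... | yes x≤y = subst₂ E (sym (above-≥ x≤y)) (sym (above-≥ (≤-trans x≤y (arc-≤ e)))) (f-hom e)
      ... | no  x≰y = subst₂ E (sym (above-≤ f (<⇒≤ y<x))) (sym (above-≤ f z≤x)) e
        where
        y<x = ≰⇒> x≰y
        z≤x = subst (_≤ φ x) (sym (φ-hom e)) (i<j⇒suc[i]≤j y<x)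

    above-inverse : ∀ f f⁻¹ → (∀ y → φ (f⁻¹ y) ≡ φ y) → (∀ y → f (f⁻¹ y) ≡ y) →
                    (∀ y → φ y ≡ φ x → f y ≡ y) → ∀ y → above f (above f⁻¹ y) ≡ y
    above-inverse f f⁻¹ level inv fix y with φ y ≤? φ x
    ... | yes y≤x = above-≤ f y≤x
    -- `f⁻¹` keeps levels, so `f⁻¹ y` is still on the side where `above f` is `f`.
    ... | no  y≰x =
      trans (above-≥ f fix (subst (φ x ≤_) (sym (level y)) (<⇒≤ (≰⇒> y≰x)))) (inv y)

    upper : ∀ a → FixesLevel x a → Automorphism Γ
    upper a fix = record
      { perm     = mk↔ₛ′ (above (to a)) (above (from a))
          (above-inverse (to a) (from a) (fixesLevel⇒preserves-φ (a ⁻¹) fix⁻¹) (strictlyInverseˡ a) fix)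
          (above-inverse (from a) (to a) (fixesLevel⇒preserves-φ a fix) (strictlyInverseʳ a) fix⁻¹)
      ; to-hom   = above-hom (to a) fix (to-hom a)
      ; from-hom = above-hom (from a) fix⁻¹ (from-hom a)
      }
      where fix⁻¹ = Subgroup.⁻¹-mem (LevelStabilizer x) {a} fix

    -- As `a` preserves levels, the inverse of `upper` cancels it from the level upwards and leaves
    -- it alone below.
    lower : ∀ a → FixesLevel x a → Automorphism Γ
    lower a fix = a ∙ upper a fix ⁻¹

    lower-≤ : ∀ a fix {y} → φ y ≤ φ x → to (lower a fix) y ≡ to a y
    lower-≤ a fix {y} y≤x =
      above-≤ (from a) (subst (_≤ φ x) (sym (fixesLevel⇒preserves-φ a fix y)) y≤x)

    lower-≥ : ∀ a fix {y} → φ x ≤ φ y → to (lower a fix) y ≡ y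
    lower-≥ a fix {y} x≤y = trans
      (above-≥ (from a) (Subgroup.⁻¹-mem (LevelStabilizer x) {a} fix)
        (subst (φ x ≤_) (sym (fixesLevel⇒preserves-φ a fix y)) x≤y))
      (strictlyInverseʳ a y)

  open Splice

  -- This bound and its dual keep the vertices already matched on the side where the spliced
  -- automorphism is the identity.
  isArc-≤last : ∀ k s → IsArc Γ k s → ∀ i → φ (s i) ≤ φ (s (fromℕ k))
  isArc-≤last zero    s arc fzero    = ≤-refl
  isArc-≤last (suc k) s arc fzero    =
    ≤-trans (arc-≤ (arc fzero)) (isArc-≤last k (s ∘ fsuc) (arc ∘ fsuc) fzero)
  isArc-≤last (suc k) s arc (fsuc i) = isArc-≤last k (s ∘ fsuc) (arc ∘ fsuc) i

  isArc-≥first : ∀ k s → IsArc Γ k s → ∀ i → φ (s fzero) ≤ φ (s i)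
  isArc-≥first k       s arc fzero    = ≤-refl
  isArc-≥first (suc k) s arc (fsuc i) =
    ≤-trans (arc-≤ (arc fzero)) (isArc-≥first k (s ∘ fsuc) (arc ∘ fsuc) i)

  -- Transport of local properties by vertex-transitivity.

  module _ (vertexTransitive : VertexTransitive Γ) where

    -- `R` stands for the arc relation or its reverse, so that out- and in-neighbours are treated at
    -- once.
    module Neighbours (R : Rel V ℓ)
      (R-resp : ∀ (g : Automorphism Γ) {x y} → R x y → R (to g x) (to g y)) where

      FixedAt TransitiveAt : V → Set ℓ
      FixedAt v      = ∀ n → FixesLevel v n → ∀ {y} → R v y → to n y ≡ y
      TransitiveAt v = ∀ {y z} → R v y → R v z → ∃[ n ] FixesLevel v n × to n y ≡ z

      neighbour : ∃₂ R → ∀ x → ∃ (R x)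
      neighbour (u , v , r) x with g , refl ← vertexTransitive u x = to g v , R-resp g r

      R-from : ∀ g {x y} → R (to g x) y → R x (from g y)
      R-from g {x} {y} r = subst (λ z → R z (from g y)) (strictlyInverseʳ g x) (R-resp (g ⁻¹) r)

      from-injective : ∀ (g : Automorphism Γ) {y z} → from g y ≡ from g z → y ≡ z
      from-injective g {y} {z} eq =
        trans (sym (strictlyInverseˡ g y)) (trans (cong (to g) eq) (strictlyInverseˡ g z))

      -- Conjugation by some `g` taking `v` to `x` turns the level stabiliser of `x` into that of
      -- `v`, while `from g` takes neighbours of `x` to neighbours of `v`.
      fixedAt : ∀ {v} → FixedAt v → ∀ x → FixedAt x
      fixedAt {v} fixed x n fix {y} r with g , refl ← vertexTransitive v x =
        from-injective g (trans (cong (from g ∘ to n) (sym (strictlyInverseˡ g y)))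
          (fixed (g ∙ n ∙ g ⁻¹) (conjugate g {n} fix) (R-from g r)))

      transitiveAt : ∀ {v} → TransitiveAt v → ∀ x → TransitiveAt x
      transitiveAt {v} transitive x {y} {z} r s with g , refl ← vertexTransitive v x
        with n , fix , eq ← transitive (R-from g r) (R-from g s) =
        g ⁻¹ ∙ n ∙ g , conjugate⁻¹ g {n} fix ,
        trans (cong (to g) eq) (strictlyInverseˡ g z)

    module O = Neighbours E to-hom
    module I = Neighbours (flip E) (λ g → to-hom g)

    -- Matching arcs by induction on their length.

    transitiveOut⇒highlyArcTransitive : (∀ x → O.TransitiveAt x) → HighlyArcTransitive Γ
    transitiveOut⇒highlyArcTransitive transitive zero s t _ _
      with g , eq ← vertexTransitive (s fzero) (t fzero) = g , λ { fzero → eq }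
    transitiveOut⇒highlyArcTransitive transitive (suc k) s t s-arc t-arc
      with g , eq ← transitiveOut⇒highlyArcTransitive transitive k
                      (s ∘ inject₁) (t ∘ inject₁) (s-arc ∘ inject₁) (t-arc ∘ inject₁)
      -- The image of the last vertex of `s` and the last vertex of `t` are both out-neighbours of
      -- `u`, so some `a` fixing the level of `u` joins them.
      with e ← subst (λ z → E z (to g (s (fromℕ (suc k))))) (eq (fromℕ k))
                 (to-hom g (s-arc (fromℕ k)))
      with a , fix , a-eq ← transitive (t (inject₁ (fromℕ k))) e (t-arc (fromℕ k)) =
      g ∙ upper u a fix , matches
      where
      u = t (inject₁ (fromℕ k))
      matches : ∀ i → to (g ∙ upper u a fix) (s i) ≡ t i
      matches i with view i
      -- The last vertex lies above `u`, where the splice acts as `a`; the others lie on or below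
      -- the level of `u` and stay put.
      ... | ‵fromℕ     = trans (above-≥ u (to a) fix (arc-≤ e)) a-eq
      ... | ‵inject₁ j = trans (cong (above u (to a)) (eq j))
        (above-≤ u (to a) (isArc-≤last k (t ∘ inject₁) (t-arc ∘ inject₁) j))

    transitiveIn⇒highlyArcTransitive : (∀ x → I.TransitiveAt x) → HighlyArcTransitive Γ
    transitiveIn⇒highlyArcTransitive transitive zero s t _ _
      with g , eq ← vertexTransitive (s fzero) (t fzero) = g , λ { fzero → eq }
    transitiveIn⇒highlyArcTransitive transitive (suc k) s t s-arc t-arc
      with g , eq ← transitiveIn⇒highlyArcTransitive transitive k
                      (s ∘ fsuc) (t ∘ fsuc) (s-arc ∘ fsuc) (t-arc ∘ fsuc)
      with e ← subst (E (to g (s fzero))) (eq fzero) (to-hom g (s-arc fzero))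
      with a , fix , a-eq ← transitive (t (fsuc fzero)) e (t-arc fzero) =
      -- Here the first vertex is corrected: it lies below `u`, and the remaining ones on or above
      -- the level of `u`.
      g ∙ lower u a fix , λ where
        fzero    → trans (lower-≤ u a fix (arc-≤ e)) a-eq
        (fsuc i) → trans (cong (to (lower u a fix)) (eq i))
          (lower-≥ u a fix (isArc-≥first k (t ∘ fsuc) (t-arc ∘ fsuc) i))
      where u = t (fsuc fzero)

    -- Trivial action on both neighbourhoods.

    arc-exists : ∀ {u v} → φ u ≡ 0ℤ → φ v ≡ 1ℤ → ∃₂ E
    arc-exists {u} {v} φu φv with connected u v
    -- Different levels rule out the empty path, so the path has a first step.
    ... | ε         = contradiction (trans (sym φu) φv) λ ()
    ... | fwd e ◅ _ = _ , _ , e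
    ... | bwd e ◅ _ = _ , _ , e

    fixedBothSides⇒trivial : ∃₂ E → (∀ x → O.FixedAt x) → (∀ x → I.FixedAt x) →
                             ∀ {x} n → FixesLevel x n → ∀ y → to n y ≡ y
    fixedBothSides⇒trivial (u , v , e) fixedO fixedI {x} n fix y =
      -- Along each arc, fixing the level of one end is equivalent to fixing that of the other;
      -- these equivalences compose along the path from `x` to `y`.
      Equivalence.to (gfold ⇔-isEquivalence (λ z → FixesLevel z n)
        (λ e′ → mk⇔ (up e′) (down e′)) (connected x y)) fix y refl
      where
      suc-injective : ∀ {i j} → sucℤ i ≡ sucℤ j → i ≡ j
      suc-injective {i} {j} eq = i-j≡0⇒i≡j i j (trans (sym (sucℤ-minus-sucℤ i j)) (i≡j⇒i-j≡0 eq))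

      up : ∀ {x y} → E x y → FixesLevel x n → FixesLevel y n
      -- Every `z` on the upper level has an in-neighbour `w`, which lies on the level that `n`
      -- fixes; `n` then fixes all out-neighbours of `w`.
      up e′ fix z eq with w , r ← I.neighbour (v , u , e) z =
        fixedO w n (λ t t≡w → fix t (trans t≡w w≡x)) r
        where w≡x = suc-injective (trans (sym (φ-hom r)) (trans eq (φ-hom e′)))

      down : ∀ {x y} → E x y → FixesLevel y n → FixesLevel x n
      down e′ fix z eq with w , r ← O.neighbour (u , v , e) z =
        fixedI w n (λ t t≡w → fix t (trans t≡w w≡y)) r
        where w≡y = trans (φ-hom r) (trans (cong sucℤ eq) (sym (φ-hom e′)))

    -- The dichotomy from quasi-primitivity.

    levelSubgroup : ∀ v → Subgroup (toGroup (Stabilizer (vertexAction Γ) v)) ℓ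
    levelSubgroup v = subgroupOf (Stabilizer (vertexAction Γ) v) (LevelStabilizer v)

    levelSubgroup-normal : ∀ v → Normal (levelSubgroup v)
    levelSubgroup-normal v (g , gv≡v) {n , _} fix =
      -- `g` fixes `v`, so the conjugate fixes the same level again.
      subst (λ w → FixesLevel w (g ⁻¹ ∙ n ∙ g)) gv≡v (conjugate⁻¹ g {n} fix)

    quasiPrimitiveOut : ∀ v → QuasiPrimitive (stabilizerOnOut Γ v) →
                        O.FixedAt v ⊎ O.TransitiveAt v
    quasiPrimitiveOut v (_ , qp) = map
      -- An element fixing the level of `v` fixes `v` itself, so it belongs to the stabiliser of
      -- `v`.
      (λ trivial n fix e → trivial {n , fix v refl} fix (_ , e))
      (λ transitive e e′ → case transitive (_ , e) (_ , e′) of λ where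
        ((n , _) , fix , eq) → n , fix , eq)
      (qp (levelSubgroup v) (levelSubgroup-normal v))

    quasiPrimitiveIn : ∀ v → QuasiPrimitive (stabilizerOnIn Γ v) →
                       I.FixedAt v ⊎ I.TransitiveAt v
    quasiPrimitiveIn v (_ , qp) = map
      (λ trivial n fix e → trivial {n , fix v refl} fix (_ , e))
      (λ transitive e e′ → case transitive (_ , e) (_ , e′) of λ where
        ((n , _) , fix , eq) → n , fix , eq)
      (qp (levelSubgroup v) (levelSubgroup-normal v))

theorem4 : ∀ {ℓ} (Γ : Digraph ℓ) →
    Connected Γ →
    VertexTransitive Γ →
    PropertyZ Γ →
    (φ : Digraph.V Γ → ℤ) →
    IsHomomorphism Γ ℤ⃗ φ →
    Surjective _≡_ _≡_ φ →
    (∃[ v ] QuasiPrimitive (stabilizerOnIn Γ v) × QuasiPrimitive (stabilizerOnOut Γ v)) →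
    NonTrivial (PointwiseStabilizer (vertexAction Γ) (λ x → φ x ≡ 0ℤ)) →
    HighlyArcTransitive Γ
theorem4 Γ connected vt _ φ φ-hom surjective (v , qpIn , qpOut) (g , fix , g≉ε)
  with quasiPrimitiveOut Γ connected φ φ-hom vt v qpOut
     | quasiPrimitiveIn Γ connected φ φ-hom vt v qpIn
... | inj₂ transitive | _ =
  transitiveOut⇒highlyArcTransitive Γ connected φ φ-hom vt
    (O.transitiveAt Γ connected φ φ-hom vt transitive)
... | inj₁ _ | inj₂ transitive =
  transitiveIn⇒highlyArcTransitive Γ connected φ φ-hom vt
    (I.transitiveAt Γ connected φ φ-hom vt transitive)
... | inj₁ fixedOut | inj₁ fixedIn = contradiction
  (fixedBothSides⇒trivial Γ connected φ φ-hom vt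
    (arc-exists Γ connected φ φ-hom vt φx₀ φx₁)
    (O.fixedAt Γ connected φ φ-hom vt fixedOut)
    (I.fixedAt Γ connected φ φ-hom vt fixedIn)
    -- Level 0 is the level of the chosen preimage of `0ℤ`.
    g (λ y eq → fix y (trans eq φx₀)))
  g≉ε
  where
  φx₀ = proj₂ (surjective 0ℤ) refl
  φx₁ = proj₂ (surjective 1ℤ) refl
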